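{- For each integer $m>0$, there exists at most one ordered triple $(x,y,z)$ of positive integers with $x\le y\le z$, all three of which are Fibonacci numbers, satisfying $$x^2+y^2+z^2=3xyz+m,$$ except in the following cases: \begin{itemize} \item if $m=2$, the ordered Fibonacci solutions are exactly the triples $(1,F(b),F(b+2))$ for each even $b\ge 2$; \item if $m=21$, the ordered Fibonacci solutions are exactly $(1,2,8)$ and $(2,2,13)$, and both are minimal. \end{itemize} Moreover, there exist infinitely many integers $m>0$ for which there is exactly one such ordered Fibonacci solution, and that solution is minimal.
   Context: $F(n)$ denotes the $n$-th Fibonacci number, $F(0)=0$, $F(1)=1$, $F(n+1)=F(n)+F(n-1)$. A solution $(x,y,z)$ of $x^2+y^2+z^2=3xyz+m$ in positive integers with $x\le y\le z$ is called a Markoff $m$-triple; it is called minimal if $z\ge 3xy$. -}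

module Defs where

open import Data.Nat using (ℕ; zero; suc; _+_; _*_; _≤_; _<_)
open import Data.Product using (Σ; ∃; _×_; _,_)
open import Relation.Binary.PropositionalEquality using (_≡_)

F : ℕ → ℕ
F zero = zero
F (suc zero) = suc zero
F (suc (suc n)) = F (suc n) + F n

IsFib : ℕ → Set
IsFib x = ∃ λ n → F n ≡ x

Triple : Set
Triple = ℕ × ℕ × ℕ

MarkoffTriple : ℕ → Triple → Set
MarkoffTriple m (x , y , z) =
  0 < x × x ≤ y × y ≤ z × x * x + y * y + z * z ≡ 3 * x * y * z + m

FibSolution : ℕ → Triple → Set
FibSolution m t@(x , y , z) = MarkoffTriple m t × IsFib x × IsFib y × IsFib z

Minimal : Triple → Set
Minimal (x , y , z) = 3 * x * y ≤ z

Even : ℕ → Set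
Even b = ∃ λ k → b ≡ k + k

{-# OPTIONS --safe #-}
-- Write F a ≤ F b ≤ F c for the triple and M(a,b,c) = F(a)² + F(b)² + F(c)² − 3F(a)F(b)F(c), so that M = m. Convexity
-- in the last entry gives M ≤ 0 when c ≤ a + b, except for (2, b, b + 2), where Cassini's identity gives M ∈ {0, 2}.
-- On the remaining index triples, c > a + b, the values of M are compared one by one. For fixed c, M decreases in a + b;
-- for fixed c and a + b, Vajda's identity gives M(3) < M(5) < M(7) < … < M(6) < M(4) < M(2) in terms of a. If c grows
-- by at least 2, or by 1 with a' + b' < c, then M grows. The overlap at c' = c + 1 = a' + b' + 1 is settled by
-- comparing neighbours in this order within one-parameter families; it contains one coincidence,
-- M(2,3,6) = M(3,3,7) = 21.
module Submission where

open import Defs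
open import Data.Nat using (ℕ; _+_; _<_; _≤_)
open import Data.Product using (Σ; ∃; _×_; _,_)
open import Data.Sum using (_⊎_)
open import Relation.Binary.PropositionalEquality using (_≡_; _≢_)
open import Data.Nat using (zero; suc; _*_; _∸_; z≤n; s≤s; z<s; s≤s⁻¹; >-nonZero; parity; _≤?_; _<?_)
open import Data.Nat.Properties
open import Data.Nat.Tactic.RingSolver using (solve-∀)
open import Data.Parity.Base using (0ℙ; 1ℙ)
open import Data.Product using (proj₁; proj₂; ∃₂)
open import Data.Sum using (inj₁; inj₂; swap)
open import Relation.Binary.Definitions using (tri<; tri≈; tri>)
open import Relation.Binary.PropositionalEquality using (refl; sym; trans; cong; cong₂; subst; subst₂)
open import Relation.Nullary using (¬_; yes; no; contradiction)
open import Relation.Nullary.Decidable using (True; toWitness)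

-- Monotonicity of `F` and the addition formula.

≤-by : ∀ {m n} r → m + r ≡ n → m ≤ n
≤-by {m} r refl = m≤m+n m r

F-pos : ∀ n → 0 < F (suc n)
F-pos zero = z<s
F-pos (suc n) = ≤-trans (F-pos n) (m≤m+n _ _)

F-step : ∀ n → F n ≤ F (suc n)
F-step zero = z≤n
F-step (suc n) = m≤m+n _ _

F-mono-≤ : ∀ {m n} → m ≤ n → F m ≤ F n
F-mono-≤ {m} m≤n with m≤n⇒∃[o]m+o≡n m≤n
... | o , refl = go m o
  where
  go : ∀ m o → F m ≤ F (m + o)
  go m zero = ≤-reflexive (cong F (sym (+-identityʳ m)))
  go m (suc o) = ≤-trans (go m o) (subst (λ k → F (m + o) ≤ F k) (sym (+-suc m o)) (F-step (m + o)))

F-mono-< : ∀ {m n} → 2 ≤ m → m < n → F m < F n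
F-mono-< {suc (suc m)} (s≤s (s≤s _)) m<n = ≤-trans (m<m+n _ (F-pos m)) (F-mono-≤ m<n)

F-double : ∀ n → F (suc (suc n)) ≤ 2 * F (suc n)
F-double n = +-monoʳ-≤ (F (suc n)) (≤-trans (F-step n) (m≤m+n _ 0))

F-add : ∀ m n → F (suc (m + n)) ≡ F (suc m) * F (suc n) + F m * F n
F-add zero n = lemma (F (suc n))
  where
  lemma : ∀ q → q ≡ 1 * q + 0
  lemma = solve-∀
F-add (suc zero) n = lemma (F (suc n)) (F n)
  where
  lemma : ∀ q p → q + p ≡ 1 * q + 1 * p
  lemma = solve-∀
F-add (suc (suc m)) n =
  trans (cong₂ _+_ (F-add (suc m) n) (F-add m n)) (lemma (F (suc m)) (F m) (F (suc n)) (F n))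
  where
  lemma : ∀ a b q p → (a + b) * q + a * p + (a * q + b * p) ≡ (a + b + a) * q + (a + b) * p
  lemma = solve-∀

-- Vajda's identity.

-- Two ways of splitting F(2n + i + j + 1) by the addition formula.
vajda-sum : ∀ n i j →
  F (n + i) * F (n + j) + F (suc n + i) * F (suc n + j) ≡
  F n * F (n + i + j) + F (suc n) * F (suc n + i + j)
vajda-sum n i j =
  trans (+-comm (F (n + i) * F (n + j)) _)
  (trans (sym (F-add (n + i) (n + j)))
  (trans (cong (λ k → F (suc k)) (index n i j))
  (trans (F-add n (n + i + j)) (+-comm (F (suc n) * F (suc n + i + j)) _))))
  where
  index : ∀ n i j → n + i + (n + j) ≡ n + (n + i + j)
  index = solve-∀

-- By `vajda-sum` the difference F(n+i)F(n+j) - F(n)F(n+i+j) changes sign when n grows by 1, so it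
-- has period 2 in n. This lets Vajda's identity be proved separately for even n, from n = 0, and
-- for odd n, from n = 1.
vajda-period : ∀ n i j →
  F n * F (n + i + j) + F (2 + n + i) * F (2 + n + j) ≡
  F (n + i) * F (n + j) + F (2 + n) * F (2 + n + i + j)
vajda-period n i j =
  cancel (X 0) (X 1) (X 2) (Y 0) (Y 1) (Y 2) (vajda-sum n i j) (vajda-sum (suc n) i j)
  where
  X Y : ℕ → ℕ
  X k = F (k + n + i) * F (k + n + j)
  Y k = F (k + n) * F (k + n + i + j)
  cancel : ∀ x x' x'' y y' y'' → x + x' ≡ y + y' → x' + x'' ≡ y' + y'' → y + x'' ≡ x + y''
  cancel x x' x'' y y' y'' e e' = +-cancelˡ-≡ (x' + y') _ _
    (trans (r₁ x' y' y x'') (trans (cong₂ _+_ e' (sym e)) (r₂ x' y' x y'')))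
    where
    r₁ : ∀ a b c d → a + b + (c + d) ≡ a + d + (c + b)
    r₁ = solve-∀
    r₂ : ∀ a b c d → b + d + (c + a) ≡ a + b + (c + d)
    r₂ = solve-∀

vajda-even : ∀ n i j → parity n ≡ 0ℙ →
  F (n + i) * F (n + j) ≡ F n * F (n + i + j) + F i * F j
vajda-even zero i j _ = refl
vajda-even (suc (suc n)) i j even = +-cancelˡ-≡ (F n * F (n + i + j)) _ _
  (trans (vajda-period n i j) (trans (cong (_+ F (2 + n) * F (2 + n + i + j)) (vajda-even n i j even))
    (regroup (F n * F (n + i + j)) (F i * F j) _)))
  where
  regroup : ∀ y f y' → y + f + y' ≡ y + (y' + f)
  regroup = solve-∀

vajda-odd : ∀ n i j → parity n ≡ 1ℙ →
  F (n + i) * F (n + j) + F i * F j ≡ F n * F (n + i + j)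
vajda-odd (suc zero) i j _ = trans (sym (F-add i j)) (sym (*-identityˡ _))
vajda-odd (suc (suc n)) i j odd = +-cancelˡ-≡ (F (n + i) * F (n + j)) _ _
  (trans (regroup (F (n + i) * F (n + j)) (F i * F j) _)
  (trans (cong (_+ F (2 + n + i) * F (2 + n + j)) (vajda-odd n i j odd)) (vajda-period n i j)))
  where
  regroup : ∀ x f x' → x + (x' + f) ≡ x + f + x'
  regroup = solve-∀

-- Bounds on products of Fibonacci numbers.

F-product-lower : ∀ i j → F (2 + (i + j)) ≤ F (2 + i) * F (2 + j)
F-product-lower i j = begin
  F (2 + (i + j))                                 ≡⟨ F-add (suc i) j ⟩
  F (2 + i) * F (1 + j) + F (1 + i) * F j         ≤⟨ +-monoʳ-≤ (F (2 + i) * F (1 + j)) (*-monoˡ-≤ (F j) (F-step (suc i))) ⟩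
  F (2 + i) * F (1 + j) + F (2 + i) * F j         ≡⟨ *-distribˡ-+ (F (2 + i)) (F (1 + j)) (F j) ⟨
  F (2 + i) * F (2 + j)                           ∎
  where open ≤-Reasoning

-- Both sides obey the Fibonacci recurrence in `i`, so `i = 0` and `i = 1` suffice; the latter is an
-- equality.
F-product-upper : ∀ i j → F (2 + i) * F (2 + j) ≤ 2 * F (1 + (i + j))
F-product-upper zero j = ≤-trans (≤-reflexive (*-identityˡ _)) (F-double j)
F-product-upper (suc zero) j = ≤-refl
F-product-upper (suc (suc i)) j = begin
  (F (3 + i) + F (2 + i)) * F (2 + j)                  ≡⟨ *-distribʳ-+ (F (2 + j)) (F (3 + i)) (F (2 + i)) ⟩
  F (3 + i) * F (2 + j) + F (2 + i) * F (2 + j)        ≤⟨ +-mono-≤ (F-product-upper (suc i) j) (F-product-upper i j) ⟩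
  2 * F (2 + (i + j)) + 2 * F (1 + (i + j))            ≡⟨ *-distribˡ-+ 2 (F (2 + (i + j))) (F (1 + (i + j))) ⟨
  2 * F (3 + (i + j))                                  ∎
  where open ≤-Reasoning

-- A larger index sum enlarges the product by a fixed factor. The surplus of one ninth is what
-- outweighs the squares in `larger-product`.
F-product-ratio : ∀ i j i' j' → i + j < i' + j' →
  9 * (F (2 + i) * F (2 + j)) ≤ 8 * (F (2 + i') * F (2 + j'))
F-product-ratio i j i' j' lt = begin
  9 * (F (2 + i) * F (2 + j))    ≤⟨ bound i j ⟩
  8 * F (3 + (i + j))            ≤⟨ *-monoʳ-≤ 8 (F-mono-≤ (s≤s (s≤s lt))) ⟩
  8 * F (2 + (i' + j'))          ≤⟨ *-monoʳ-≤ 8 (F-product-lower i' j') ⟩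
  8 * (F (2 + i') * F (2 + j'))  ∎
  where
  open ≤-Reasoning
  expand : ∀ p q → 9 * (2 * q) + (2 * (2 * p) + 4 * p) ≡ 8 * (q + p + q) + 2 * q
  expand = solve-∀
  growth : ∀ n → 9 * (2 * F (2 + n)) ≤ 8 * F (4 + n)
  growth n = +-cancelʳ-≤ (2 * F (2 + n)) _ _ (begin
    9 * (2 * F (2 + n)) + 2 * F (2 + n)                                  ≤⟨ +-monoʳ-≤ (9 * (2 * F (2 + n))) (*-monoʳ-≤ 2 (F-double n)) ⟩
    9 * (2 * F (2 + n)) + 2 * (2 * F (1 + n))                            ≤⟨ +-monoʳ-≤ (9 * (2 * F (2 + n))) (m≤m+n _ (4 * F (1 + n))) ⟩
    9 * (2 * F (2 + n)) + (2 * (2 * F (1 + n)) + 4 * F (1 + n))          ≡⟨ expand (F (1 + n)) (F (2 + n)) ⟩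
    8 * F (4 + n) + 2 * F (2 + n)                                        ∎)
  bound : ∀ i j → 9 * (F (2 + i) * F (2 + j)) ≤ 8 * F (3 + (i + j))
  -- Here `F-product-upper` would only lead to 18 ≤ 16, so the case is computed directly.
  bound zero zero = toWitness {a? = 9 ≤? 16} _
  bound zero (suc j) = ≤-trans (*-monoʳ-≤ 9 (F-product-upper zero (suc j))) (growth j)
  bound (suc i) j = ≤-trans (*-monoʳ-≤ 9 (F-product-upper (suc i) j)) (growth (i + j))

-- With u, v the predecessors of x, y, the addition formula gives F(a + b + 1) = (x + u)(y + v) +
-- xy. After doubling, x ≤ 2u and y ≤ 2v supply the missing 2xy, and 2uv > 0 makes the inequality
-- strict.
F-minimal : ∀ {a b c} → 2 ≤ a → 2 ≤ b → a + b < c → 3 * F a * F b < F c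
F-minimal {suc (suc i)} {suc (suc j)} {c} (s≤s (s≤s _)) (s≤s (s≤s _)) lt =
  ≤-trans (*-cancelˡ-< 2 _ _ doubled) (F-mono-≤ lt)
  where
  open ≤-Reasoning
  split : ∀ x y u v → 2 * ((x + u) * (y + v) + x * y) ≡ 4 * (x * y) + (x * (2 * v) + y * (2 * u)) + 2 * (u * v)
  split = solve-∀
  join : ∀ x y → 2 * (3 * x * y) ≡ 4 * (x * y) + (x * y + y * x) + 0
  join = solve-∀
  x = F (2 + i)
  y = F (2 + j)
  u = F (1 + i)
  v = F (1 + j)
  doubled : 2 * (3 * x * y) < 2 * F (suc (2 + i + (2 + j)))
  doubled = begin-strict
    2 * (3 * x * y)                                             ≡⟨ join x y ⟩
    4 * (x * y) + (x * y + y * x) + 0                           <⟨ +-mono-≤-< (+-monoʳ-≤ (4 * (x * y))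
                                                                     (+-mono-≤ (*-monoʳ-≤ x (F-double j)) (*-monoʳ-≤ y (F-double i))))
                                                                     (*-mono-≤ {1} {2} (s≤s z≤n) (*-mono-≤ (F-pos i) (F-pos j))) ⟩
    4 * (x * y) + (x * (2 * v) + y * (2 * u)) + 2 * (u * v)     ≡⟨ split x y u v ⟨
    2 * ((x + u) * (y + v) + x * y)                             ≡⟨ cong (2 *_) (F-add (2 + i) (2 + j)) ⟨
    2 * F (suc (2 + i + (2 + j)))                               ∎

F-sum-product : ∀ i j → F (suc i + suc j) ≤ 3 * (F (suc i) * F (suc j))
F-sum-product i j = begin
  F (suc (i + suc j))                                              ≡⟨ F-add i (suc j) ⟩
  F (suc i) * F (2 + j) + F i * F (suc j)                          ≤⟨ +-mono-≤ (*-monoʳ-≤ (F (suc i)) (F-double j)) (*-monoˡ-≤ (F (suc j)) (F-step i)) ⟩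
  F (suc i) * (2 * F (suc j)) + F (suc i) * F (suc j)              ≡⟨ collect (F (suc i)) (F (suc j)) ⟩
  3 * (F (suc i) * F (suc j))                                      ∎
  where
  open ≤-Reasoning
  collect : ∀ a b → a * (2 * b) + a * b ≡ 3 * (a * b)
  collect = solve-∀

-- An auxiliary factor F(n + 2) is moved across: w ≤ F(n + 2)F(t + 1) and w·F(n + 2) ≤ F(t + 2n +
-- 2), both by the addition formula.
F-square-bound : ∀ n t → F (suc (t + n)) * F (suc (t + n)) ≤ F (suc (t + n + suc n)) * F (suc t)
F-square-bound n t = begin
  w * w                                            ≤⟨ *-monoʳ-≤ w w≤ ⟩
  w * (F (2 + n) * F (suc t))                      ≡⟨ *-assoc w _ _ ⟨
  w * F (2 + n) * F (suc t)                        ≤⟨ *-monoˡ-≤ (F (suc t)) z≥ ⟩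
  F (suc (t + n + suc n)) * F (suc t)              ∎
  where
  open ≤-Reasoning
  w = F (suc (t + n))
  collect : ∀ a b c → c * a + c * b ≡ (a + b) * c
  collect = solve-∀
  z≥ : w * F (2 + n) ≤ F (suc (t + n + suc n))
  z≥ = ≤-trans (m≤m+n _ (F (t + n) * F (suc n))) (≤-reflexive (sym (F-add (t + n) (suc n))))
  w≤ : w ≤ F (2 + n) * F (suc t)
  w≤ = begin
    w                                               ≡⟨ F-add t n ⟩
    F (suc t) * F (suc n) + F t * F n               ≤⟨ +-monoʳ-≤ (F (suc t) * F (suc n)) (*-monoˡ-≤ (F n) (F-step t)) ⟩
    F (suc t) * F (suc n) + F (suc t) * F n         ≡⟨ collect (F (suc n)) (F n) (F (suc t)) ⟩
    F (2 + n) * F (suc t)                           ∎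

-- The right side is the amount by which Vajda's identity changes 3xyz. It is at least the largest
-- square involved, so at equal index sums the products decide the comparison.
F-gap : ∀ n i j {c} → n + suc i + (n + suc j) < c →
  F (n + suc i + suc j) * F (n + suc i + suc j) ≤ 3 * (F (suc i) * F (suc j)) * F c
F-gap n i j {c} lt = begin
  F (n + suc i + suc j) * F (n + suc i + suc j)                ≡⟨ cong (λ k → F k * F k) (e₁ n i j) ⟩
  F (suc (i + suc j + n)) * F (suc (i + suc j + n))            ≤⟨ F-square-bound n (i + suc j) ⟩
  F (suc (i + suc j + n + suc n)) * F (suc (i + suc j))        ≤⟨ *-mono-≤ (F-mono-≤ (≤-trans (≤-reflexive (e₂ n i j)) lt)) (F-sum-product i j) ⟩
  F c * (3 * (F (suc i) * F (suc j)))                          ≡⟨ *-comm (F c) _ ⟩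
  3 * (F (suc i) * F (suc j)) * F c                            ∎
  where
  open ≤-Reasoning
  e₁ : ∀ n i j → n + (1 + i) + (1 + j) ≡ 1 + (i + (1 + j) + n)
  e₁ = solve-∀
  e₂ : ∀ n i j → 1 + (i + (1 + j) + n + (1 + n)) ≡ 1 + (n + (1 + i) + (n + (1 + j)))
  e₂ = solve-∀

-- The order of index triples by the value of M.

squares product : Triple → ℕ
squares (a , b , c) = F a * F a + F b * F b + F c * F c
product (a , b , c) = 3 * F a * F b * F c

-- Comparison of the values x² + y² + z² − 3xyz at triples of Fibonacci indices, free of subtraction.
infix 4 _≺_ _≼_
record _≺_ (s t : Triple) : Set where
  constructor mk≺
  field
    compare : squares s + product t < squares t + product s

_≼_ : Triple → Triple → Set
s ≼ t = s ≡ t ⊎ s ≺ t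

≺-trans : ∀ {s t u} → s ≺ t → t ≺ u → s ≺ u
≺-trans {s} {t} {u} (mk≺ p) (mk≺ q) = mk≺ (+-cancelʳ-< (squares t + product t) _ _
  (subst₂ _<_ (r₁ (squares s) (product t) (squares t) (product u)) (r₂ (squares t) (product s) (squares u) (product t))
    (+-mono-< p q)))
  where
  r₁ : ∀ a b c d → a + b + (c + d) ≡ a + d + (c + b)
  r₁ = solve-∀
  r₂ : ∀ a b c d → a + b + (c + d) ≡ c + b + (a + d)
  r₂ = solve-∀

≼-≺-trans : ∀ {s t u} → s ≼ t → t ≺ u → s ≺ u
≼-≺-trans (inj₁ refl) q = q
≼-≺-trans (inj₂ p) q = ≺-trans p q

≺-≼-trans : ∀ {s t u} → s ≺ t → t ≼ u → s ≺ u
≺-≼-trans p (inj₁ refl) = p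
≺-≼-trans p (inj₂ q) = ≺-trans p q

evaluate : ∀ s t {_ : True (squares s + product t <? squares t + product s)} → s ≺ t
evaluate s t {w} = mk≺ (toWitness w)

-- With p = F n and q = F (n + 1) the two sides of shift n s ≺ shift n t are quadratic forms in p, q plus a constant;
-- as q ≥ 1, it suffices to compare coefficients, the constant together with the coefficient of q².
shift : ℕ → Triple → Triple
shift n (a , b , c) = a , suc (b + n) , suc (c + n)

-- Coefficients of p², pq and q² in `squares (shift n s) + product (shift n t)`, read off from F(b +
-- n + 1) = F(b + 1)q + F(b)p. The first index stays fixed, so the product term is quadratic too.
coeff-pp coeff-pq coeff-qq : Triple → Triple → ℕ
coeff-pp (a , b , c) (a' , b' , c') = F b * F b + F c * F c + 3 * F a' * (F b' * F c')
coeff-pq (a , b , c) (a' , b' , c') =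
  2 * (F b * F (suc b) + F c * F (suc c)) + 3 * F a' * (F b' * F (suc c') + F (suc b') * F c')
coeff-qq (a , b , c) (a' , b' , c') =
  F (suc b) * F (suc b) + F (suc c) * F (suc c) + 3 * F a' * (F (suc b') * F (suc c'))

constant : Triple → ℕ
constant (a , _ , _) = F a * F a

shift-form : ∀ n s t → squares (shift n s) + product (shift n t) ≡
  constant s + coeff-qq s t * (F (suc n) * F (suc n)) + (coeff-pq s t * (F n * F (suc n)) + coeff-pp s t * (F n * F n))
shift-form n (a , b , c) (a' , b' , c')
  rewrite F-add b n | F-add c n | F-add b' n | F-add c' n =
  expand (F a) (F (suc b)) (F b) (F (suc c)) (F c) (F a') (F (suc b')) (F b') (F (suc c')) (F c') (F n) (F (suc n))
  where
  expand : ∀ x u v k l x' u' v' k' l' p q →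
    x * x + (u * q + v * p) * (u * q + v * p) + (k * q + l * p) * (k * q + l * p)
      + 3 * x' * (u' * q + v' * p) * (k' * q + l' * p) ≡
    x * x + (u * u + k * k + 3 * x' * (u' * k')) * (q * q)
      + ((2 * (v * u + l * k) + 3 * x' * (v' * k' + u' * l')) * (p * q) + (v * v + l * l + 3 * x' * (v' * l')) * (p * p))
  expand = solve-∀

coefficientwise : ∀ s t
  {_ : True (coeff-pp s t ≤? coeff-pp t s)} {_ : True (coeff-pq s t ≤? coeff-pq t s)}
  {_ : True (coeff-qq s t ≤? coeff-qq t s)} {_ : True (constant s + coeff-qq s t <? constant t + coeff-qq t s)} →
  ∀ n → shift n s ≺ shift n t
coefficientwise s t {pp} {pq} {qq} {cc} n
  with m≤n⇒∃[o]m+o≡n (*-mono-≤ (F-pos n) (F-pos n))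
... | r , q²≡1+r = mk≺ (subst₂ _<_ (sym (shift-form n s t)) (sym (shift-form n t s))
  (+-mono-<-≤ (subst (λ q² → constant s + coeff-qq s t * q² < constant t + coeff-qq t s * q²) q²≡1+r
      (subst₂ _<_ (regroup (constant s) (coeff-qq s t) r) (regroup (constant t) (coeff-qq t s) r)
        (+-mono-<-≤ (toWitness cc) (*-monoˡ-≤ r (toWitness qq)))))
    (+-mono-≤ (*-monoˡ-≤ (F n * F (suc n)) (toWitness pq)) (*-monoˡ-≤ (F n * F n) (toWitness pp)))))
  where
  regroup : ∀ a k r → a + k + k * r ≡ a + k * (1 + r)
  regroup = solve-∀

-- Comparisons at a fixed last index.

-- The two hypotheses give 3(x'y' - xy)z ≥ x'y'z/3 ≥ (x'y')², while x'² + y'² ≤ 1 + (x'y')² and x² +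
-- y² > 1. Multiplication by 3 clears the denominator.
larger-product : ∀ x y x' y' z → 0 < x → 0 < y → 0 < x' → 0 < y' →
  3 * x' * y' ≤ z → 9 * (x * y) ≤ 8 * (x' * y') →
  x' * x' + y' * y' + z * z + 3 * x * y * z < x * x + y * y + z * z + 3 * x' * y' * z
larger-product x y x'@(suc u) y'@(suc v) z x>0 y>0 _ _ le ratio = *-cancelˡ-< 3 _ _ (begin-strict
  3 * (x' * x' + y' * y' + z * z + 3 * x * y * z)                 ≡⟨ e₁ (x' * x' + y' * y') x y z ⟩
  3 * (x' * x' + y' * y') + 9 * (x * y) * z + rest                ≤⟨ +-monoˡ-≤ rest (+-mono-≤ (*-monoʳ-≤ 3 bound) (*-monoˡ-≤ z ratio)) ⟩
  3 * (1 + x' * y' * (x' * y')) + 8 * (x' * y') * z + rest        ≡⟨ e₃ x' y' z ⟩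
  3 * x' * y' * (x' * y') + (3 + 8 * (x' * y') * z + rest)        ≤⟨ +-monoˡ-≤ (3 + 8 * (x' * y') * z + rest) (*-monoˡ-≤ (x' * y') le) ⟩
  z * (x' * y') + (3 + 8 * (x' * y') * z + rest)                  ≡⟨ e₄ x' y' z ⟩
  3 * 1 + (9 * (x' * y') * z + rest)                              <⟨ +-monoˡ-< (9 * (x' * y') * z + rest) (*-monoʳ-< 3 (+-mono-≤ (*-mono-≤ x>0 x>0) (*-mono-≤ y>0 y>0))) ⟩
  3 * (x * x + y * y) + (9 * (x' * y') * z + rest)                ≡⟨ e₅ (x * x + y * y) x' y' z ⟩
  3 * (x * x + y * y + z * z + 3 * x' * y' * z)                   ∎)
  where
  open ≤-Reasoning
  rest = 3 * (z * z)
  e₁ : ∀ s x y z → 3 * (s + z * z + 3 * x * y * z) ≡ 3 * s + 9 * (x * y) * z + 3 * (z * z)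
  e₁ = solve-∀
  e₂ : ∀ u v → (1 + u) * (1 + u) + (1 + v) * (1 + v) + (2 * u + u * u) * (2 * v + v * v) ≡
    1 + (1 + u) * (1 + v) * ((1 + u) * (1 + v))
  e₂ = solve-∀
  -- Equivalent to (x'² - 1)(y'² - 1) ≥ 0.
  bound : x' * x' + y' * y' ≤ 1 + x' * y' * (x' * y')
  bound = ≤-by ((2 * u + u * u) * (2 * v + v * v)) (e₂ u v)
  e₃ : ∀ x y z → 3 * (1 + x * y * (x * y)) + 8 * (x * y) * z + 3 * (z * z) ≡
    3 * x * y * (x * y) + (3 + 8 * (x * y) * z + 3 * (z * z))
  e₃ = solve-∀
  e₄ : ∀ x y z → z * (x * y) + (3 + 8 * (x * y) * z + 3 * (z * z)) ≡ 3 * 1 + (9 * (x * y) * z + 3 * (z * z))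
  e₄ = solve-∀
  e₅ : ∀ s x y z → 3 * s + (9 * (x * y) * z + 3 * (z * z)) ≡ 3 * (s + z * z + 3 * x * y * z)
  e₅ = solve-∀

F-positive : ∀ {n} → 2 ≤ n → 0 < F n
F-positive {suc n} _ = F-pos n

larger-sum : ∀ {a b a' b' c} → 2 ≤ a → 2 ≤ b → 2 ≤ a' → 2 ≤ b' → a + b < a' + b' → a' + b' < c →
  (a' , b' , c) ≺ (a , b , c)
larger-sum {suc (suc i)} {suc (suc j)} {suc (suc i')} {suc (suc j')} {c}
    (s≤s (s≤s _)) (s≤s (s≤s _)) (s≤s (s≤s _)) (s≤s (s≤s _)) lt lt' =
  mk≺ (larger-product (F (2 + i)) (F (2 + j)) (F (2 + i')) (F (2 + j')) (F c)
    (F-pos (suc i)) (F-pos (suc j)) (F-pos (suc i')) (F-pos (suc j'))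
    (<⇒≤ (F-minimal {2 + i'} {2 + j'} (s≤s (s≤s z≤n)) (s≤s (s≤s z≤n)) lt'))
    (F-product-ratio i j i' j' (+-cancelˡ-< 4 _ _ (subst₂ _<_ (index i j) (index i' j') lt))))
  where
  index : ∀ i j → 2 + i + (2 + j) ≡ 4 + (i + j)
  index = solve-∀

-- Puts a pair nested inside another with the same sum into the shape of Vajda's identity with n =
-- a₀.
spread : ∀ {a₀ b₀ a b} → a₀ < a → a ≤ b → a + b ≡ a₀ + b₀ →
  ∃₂ λ i j → a ≡ a₀ + suc i × b ≡ a₀ + suc j × b₀ ≡ a₀ + suc i + suc j
spread {a₀} {b₀} a₀<a a≤b sum with m≤n⇒∃[o]m+o≡n a₀<a | m≤n⇒∃[o]m+o≡n a≤b
... | i , refl | e , refl = i , i + e , sym (+-suc a₀ i) , index₁ a₀ i e ,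
  +-cancelˡ-≡ a₀ _ _ (trans (sym sum) (index₂ a₀ i e))
  where
  index₁ : ∀ n i e → 1 + n + i + e ≡ n + (1 + (i + e))
  index₁ = solve-∀
  index₂ : ∀ n i e → 1 + n + i + (1 + n + i + e) ≡ n + (n + (1 + i) + (1 + (i + e)))
  index₂ = solve-∀

-- For even a₀ the outer pair has the smaller product, by f = F(i + 1)F(j + 1). By `F-gap`, 3fz
-- covers one of the two squares w² that bound u² + v², and F(a₀)² > 0 makes the result strict.
-- `odd-min` is the mirror image.
even-max : ∀ {a₀ b₀ a b c} → parity a₀ ≡ 0ℙ → 2 ≤ a₀ → a₀ < a → a ≤ b → a + b ≡ a₀ + b₀ → a + b < c →
  (a , b , c) ≺ (a₀ , b₀ , c)
even-max {n} {c = c} even 2≤n n<a a≤b sum lt with spread n<a a≤b sum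
... | i , j , refl , refl , refl = mk≺ (begin-strict
  u * u + v * v + z * z + 3 * n₀ * w * z                              ≤⟨ +-monoˡ-≤ (3 * n₀ * w * z) (+-monoˡ-≤ (z * z) (+-mono-≤ (*-mono-≤ u≤w u≤w) (*-mono-≤ v≤w v≤w))) ⟩
  w * w + w * w + z * z + 3 * n₀ * w * z                              ≤⟨ +-monoˡ-≤ (3 * n₀ * w * z) (+-monoˡ-≤ (z * z) (+-monoʳ-≤ (w * w) (F-gap n i j lt))) ⟩
  w * w + 3 * f * z + z * z + 3 * n₀ * w * z                          <⟨ m<n+m _ (*-mono-≤ (F-positive 2≤n) (F-positive 2≤n)) ⟩
  n₀ * n₀ + (w * w + 3 * f * z + z * z + 3 * n₀ * w * z)              ≡⟨ regroup n₀ w f z ⟩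
  n₀ * n₀ + w * w + z * z + 3 * (n₀ * w + f) * z                      ≡⟨ cong (λ p → n₀ * n₀ + w * w + z * z + 3 * p * z) (vajda-even n (suc i) (suc j) even) ⟨
  n₀ * n₀ + w * w + z * z + 3 * (u * v) * z                           ≡⟨ cong (λ p → n₀ * n₀ + w * w + z * z + p * z) (*-assoc 3 u v) ⟨
  n₀ * n₀ + w * w + z * z + 3 * u * v * z                             ∎)
  where
  open ≤-Reasoning
  n₀ = F n
  u = F (n + suc i)
  v = F (n + suc j)
  w = F (n + suc i + suc j)
  z = F c
  f = F (suc i) * F (suc j)
  u≤w : u ≤ w
  u≤w = F-mono-≤ {n + suc i} (m≤m+n _ _)
  v≤w : v ≤ w
  v≤w = F-mono-≤ (+-monoˡ-≤ (suc j) (m≤m+n n (suc i)))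
  regroup : ∀ n w f z → n * n + (w * w + 3 * f * z + z * z + 3 * n * w * z) ≡ n * n + w * w + z * z + 3 * (n * w + f) * z
  regroup = solve-∀

odd-min : ∀ {a₀ b₀ a b c} → parity a₀ ≡ 1ℙ → 2 ≤ a₀ → a₀ < a → a ≤ b → a + b ≡ a₀ + b₀ → a + b < c →
  (a₀ , b₀ , c) ≺ (a , b , c)
odd-min {n} {c = c} odd 2≤n n<a a≤b sum lt with spread n<a a≤b sum
... | i , j , refl , refl , refl = mk≺ (begin-strict
  n₀ * n₀ + w * w + z * z + 3 * u * v * z                     ≤⟨ +-monoˡ-≤ (3 * u * v * z) (+-monoˡ-≤ (z * z) (+-mono-≤ (*-mono-≤ n₀≤u n₀≤u) (F-gap n i j lt))) ⟩
  u * u + 3 * f * z + z * z + 3 * u * v * z                   <⟨ m<n+m _ (*-mono-≤ v>0 v>0) ⟩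
  v * v + (u * u + 3 * f * z + z * z + 3 * u * v * z)         ≡⟨ regroup u v f z ⟩
  u * u + v * v + z * z + 3 * (u * v + f) * z                 ≡⟨ cong (λ p → u * u + v * v + z * z + 3 * p * z) (vajda-odd n (suc i) (suc j) odd) ⟩
  u * u + v * v + z * z + 3 * (n₀ * w) * z                    ≡⟨ cong (λ p → u * u + v * v + z * z + p * z) (*-assoc 3 n₀ w) ⟨
  u * u + v * v + z * z + 3 * n₀ * w * z                      ∎)
  where
  open ≤-Reasoning
  n₀ = F n
  u = F (n + suc i)
  v = F (n + suc j)
  w = F (n + suc i + suc j)
  z = F c
  f = F (suc i) * F (suc j)
  n₀≤u : n₀ ≤ u
  n₀≤u = F-mono-≤ {n} (m≤m+n _ _)
  v>0 : 0 < v
  v>0 = F-positive (≤-trans 2≤n (m≤m+n _ _))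
  regroup : ∀ u v f z → v * v + (u * u + 3 * f * z + z * z + 3 * u * v * z) ≡ u * u + v * v + z * z + 3 * (u * v + f) * z
  regroup = solve-∀

even-max-≼ : ∀ {a₀ b₀ a b c} → parity a₀ ≡ 0ℙ → 2 ≤ a₀ → a₀ ≤ a → a ≤ b → a + b ≡ a₀ + b₀ → a + b < c →
  (a , b , c) ≼ (a₀ , b₀ , c)
even-max-≼ {a₀} even 2≤a₀ a₀≤a a≤b sum lt with m≤n⇒m<n∨m≡n a₀≤a
... | inj₁ a₀<a = inj₂ (even-max even 2≤a₀ a₀<a a≤b sum lt)
... | inj₂ refl = inj₁ (cong (λ b → a₀ , b , _) (+-cancelˡ-≡ a₀ _ _ sum))

odd-min-≼ : ∀ {a₀ b₀ a b c} → parity a₀ ≡ 1ℙ → 2 ≤ a₀ → a₀ ≤ a → a ≤ b → a + b ≡ a₀ + b₀ → a + b < c →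
  (a₀ , b₀ , c) ≼ (a , b , c)
odd-min-≼ {a₀} odd 2≤a₀ a₀≤a a≤b sum lt with m≤n⇒m<n∨m≡n a₀≤a
... | inj₁ a₀<a = inj₂ (odd-min odd 2≤a₀ a₀<a a≤b sum lt)
... | inj₂ refl = inj₁ (cong (λ b → a₀ , b , _) (sym (+-cancelˡ-≡ a₀ _ _ sum)))

-- Extremal index triples with c > a + b.

-- The bound 2 ≤ a removes the ambiguity F(1) = F(2).
Code : Triple → Set
Code (a , b , c) = 2 ≤ a × a ≤ b × a + b < c

-- A larger sum lowers M, and within one sum the first index 2 is the greatest.
≼-two : ∀ b₀ {a b c} → 2 ≤ b₀ → Code (a , b , c) → 2 + b₀ ≤ a + b → (a , b , c) ≼ (2 , b₀ , c)
≼-two b₀ 2≤b₀ (2≤a , a≤b , lt) le with m≤n⇒m<n∨m≡n le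
... | inj₁ less = inj₂ (larger-sum ≤-refl 2≤b₀ 2≤a (≤-trans 2≤a a≤b) less lt)
... | inj₂ same = even-max-≼ refl ≤-refl 2≤a a≤b (sym same) lt

-- Dually, the largest admissible sum is lowest, and within it the first index 3.
three-≼ : ∀ b₀ {a b c} → 3 ≤ b₀ → Code (a , b , c) → a + b ≤ 3 + b₀ → 3 + b₀ < c → (3 , b₀ , c) ≼ (a , b , c)
three-≼ b₀ 3≤b₀ (2≤a , a≤b , lt) le lt₀ with m≤n⇒m<n∨m≡n le
... | inj₁ less = inj₂ (larger-sum 2≤a (≤-trans 2≤a a≤b) (s≤s (s≤s z≤n)) (≤-trans (n≤1+n 2) 3≤b₀) less lt₀)
... | inj₂ same with m≤n⇒m<n∨m≡n 2≤a
...   | inj₁ 3≤a = odd-min-≼ refl (s≤s (s≤s z≤n)) 3≤a a≤b same lt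
...   | inj₂ refl = inj₂ (even-max refl ≤-refl ≤-refl 3≤b₀ (sym same) lt₀)

-- As (2, b₀, c) is the greatest of its own sum, the other triples of that sum must be excluded.
two-≼ : ∀ b₀ {a b c} → 2 ≤ b₀ → Code (a , b , c) → a + b ≤ 2 + b₀ → a ≡ 2 ⊎ a + b < 2 + b₀ → 2 + b₀ < c →
  (2 , b₀ , c) ≼ (a , b , c)
two-≼ b₀ 2≤b₀ (2≤a , a≤b , lt) le cases lt₀ with m≤n⇒m<n∨m≡n le | cases
... | inj₁ less | _         = inj₂ (larger-sum 2≤a (≤-trans 2≤a a≤b) ≤-refl 2≤b₀ less lt₀)
... | inj₂ _    | inj₂ less = inj₂ (larger-sum 2≤a (≤-trans 2≤a a≤b) ≤-refl 2≤b₀ less lt₀)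
... | inj₂ refl | inj₁ refl = inj₁ refl

≼-four : ∀ b₀ {a b c} → 4 ≤ b₀ → 3 ≤ a → a ≤ b → a + b ≡ 4 + b₀ → a + b < c → (a , b , c) ≼ (4 , b₀ , c)
≼-four b₀ {c = c} 4≤b₀ 3≤a a≤b same lt with m≤n⇒m<n∨m≡n 3≤a
... | inj₁ 4≤a = even-max-≼ refl (s≤s (s≤s z≤n)) 4≤a a≤b same lt
... | inj₂ refl = inj₂ (odd-min refl (s≤s (s≤s z≤n)) ≤-refl 4≤b₀ (sym same) (subst (_< c) same lt))

half : ∀ k {a b} → k ≤ a → a ≤ b → a + b ≤ suc (k + k) → a ≡ k
half k k≤a a≤b le with m≤n⇒m<n∨m≡n k≤a
... | inj₂ k≡a = sym k≡a
... | inj₁ k<a = contradiction (≤-trans (≤-reflexive (cong suc (sym (+-suc k k)))) (+-mono-≤ k<a (≤-trans k<a a≤b)))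
  (<⇒≱ (s≤s le))

code-c≥5 : ∀ {a b c} → Code (a , b , c) → 5 ≤ c
code-c≥5 (2≤a , a≤b , lt) = ≤-trans (s≤s (+-mono-≤ 2≤a (≤-trans 2≤a a≤b))) lt

code-sum≥4 : ∀ {a b c} → Code (a , b , c) → 4 ≤ a + b
code-sum≥4 (2≤a , a≤b , _) = +-mono-≤ 2≤a (≤-trans 2≤a a≤b)

≼-two-two : ∀ {a b c} → Code (a , b , c) → (a , b , c) ≼ (2 , 2 , c)
≼-two-two code = ≼-two 2 ≤-refl code (code-sum≥4 code)

-- Cassini's identity and comparisons across different last indices.

cassini-even : ∀ n → parity n ≡ 0ℙ → F (suc n) * F (suc n) ≡ F n * F (2 + n) + 1
cassini-even n even =
  subst₂ (λ k l → F k * F k ≡ F n * F l + 1) (+-comm n 1) (trans (+-comm (n + 1) 1) (cong suc (+-comm n 1)))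
    (vajda-even n 1 1 even)

cassini-odd : ∀ n → parity n ≡ 1ℙ → F (suc n) * F (suc n) + 1 ≡ F n * F (2 + n)
cassini-odd n odd =
  subst₂ (λ k l → F k * F k + 1 ≡ F n * F l) (+-comm n 1) (trans (+-comm (n + 1) 1) (cong suc (+-comm n 1)))
    (vajda-odd n 1 1 odd)

even-or-odd : ∀ n → parity n ≡ 0ℙ ⊎ parity n ≡ 1ℙ
even-or-odd n with parity n
... | 0ℙ = inj₁ refl
... | 1ℙ = inj₂ refl

cassini-≤ : ∀ n → F n * F (2 + n) ≤ F (suc n) * F (suc n) + 1
cassini-≤ n with even-or-odd n
... | inj₁ even = ≤-trans (m≤m+n _ 1) (≤-trans (≤-reflexive (sym (cassini-even n even))) (m≤m+n _ 1))
... | inj₂ odd = ≤-reflexive (sym (cassini-odd n odd))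

-- Here M = 2 + z² - 3z, and raising z by d > 0 adds d(2z + d - 3), which is positive for z ≥ 2.
two-two-mono : ∀ {c d} → 3 ≤ c → c ≤ d → (2 , 2 , c) ≼ (2 , 2 , d)
two-two-mono {c} {d} 3≤c c≤d with m≤n⇒m<n∨m≡n c≤d
... | inj₂ refl = inj₁ refl
... | inj₁ c<d = inj₂ (mk≺ (lemma (F-mono-≤ 3≤c) (F-mono-< (≤-trans (n≤1+n 2) 3≤c) c<d)))
  where
  expand : ∀ z d → 2 + z * z + 3 * z + d * (2 * z + d) ≡ 2 + (z + d) * (z + d) + 3 * z
  expand = solve-∀
  regroup : ∀ z d → 2 + z * z + 3 * (z + d) ≡ 2 + z * z + 3 * z + d * 3
  regroup = solve-∀
  lemma : ∀ {z z'} → 2 ≤ z → z < z' → 2 + z * z + 3 * z' < 2 + z' * z' + 3 * z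
  lemma {z} {z'} 2≤z z<z' with m≤n⇒∃[o]m+o≡n (<⇒≤ z<z')
  ... | d , refl = subst₂ _<_ (sym (regroup z d)) (expand z d) (+-monoʳ-< (2 + z * z + 3 * z)
    (*-monoʳ-< d {{>-nonZero d>0}} (≤-trans (*-monoʳ-≤ 2 2≤z) (m≤m+n (2 * z) d))))
    where
    d>0 : 0 < d
    d>0 = +-cancelˡ-< z 0 d (subst (_< z + d) (sym (+-identityʳ z)) z<z')

-- The leading terms agree here: the difference of the two values is 4 + 8(−1)ⁿ⁺¹ + 3 F (5 + n) − 2.
two-two-≺-three : ∀ n → (2 , 2 , 5 + n) ≺ (3 , 3 + n , 7 + n)
two-two-≺-three n = mk≺ (+-cancelʳ-< (8 * (t * t + 1) + 6) _ _ (begin-strict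
  2 + z * z + 6 * y * z' + (8 * (t * t + 1) + 6)                      <⟨ +-monoʳ-< (2 + z * z + 6 * y * z') (+-monoʳ-< (8 * (t * t + 1)) (*-monoʳ-< 3 {2} {z} (F-mono-≤ {4} {5 + n} (s≤s (s≤s (s≤s (s≤s z≤n))))))) ⟩
  2 + z * z + 6 * y * z' + (8 * (t * t + 1) + 3 * z)                  ≡⟨ expand y t ⟩
  4 + y * y + z' * z' + 3 * z + (8 * (y * (t + y)) + 6)               ≤⟨ +-monoʳ-≤ (4 + y * y + z' * z' + 3 * z) (+-monoˡ-≤ 6 (*-monoʳ-≤ 8 (cassini-≤ (3 + n)))) ⟩
  4 + y * y + z' * z' + 3 * z + (8 * (t * t + 1) + 6)                 ∎))
  where
  open ≤-Reasoning
  y = F (3 + n)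
  t = F (4 + n)
  z = F (5 + n)
  z' = F (7 + n)
  expand : ∀ y t →
    2 + (t + y) * (t + y) + 6 * y * (t + y + t + (t + y)) + (8 * (t * t + 1) + 3 * (t + y)) ≡
    4 + y * y + (t + y + t + (t + y)) * (t + y + t + (t + y)) + 3 * (t + y) + (8 * (y * (t + y)) + 6)
  expand = solve-∀

-- The middle index 2 does not move with n, so this family is not of the `shift` form. In p = F(n),
-- q = F(n + 1) the difference is a polynomial with positive coefficients.
two-two-≺-next : ∀ n → (2 , 2 , 7 + n) ≺ (3 , 3 + n , 8 + n)
two-two-≺-next n = mk≺ (lemma (F (3 + n)) (F (7 + n)) (F (8 + n)) (F n) (F (suc n)) (F-add 2 n) (F-add 6 n) (F-add 7 n))
  where
  expand : ∀ p q →
    2 + (13 * q + 8 * p) * (13 * q + 8 * p) + 6 * (2 * q + 1 * p) * (21 * q + 13 * p)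
      + (24 * (q * q) + 60 * (p * q) + 28 * (p * p) + 3 * (13 * q + 8 * p) + 2) ≡
    4 + (2 * q + 1 * p) * (2 * q + 1 * p) + (21 * q + 13 * p) * (21 * q + 13 * p) + 3 * (13 * q + 8 * p)
  expand = solve-∀
  lemma : ∀ y z z' p q → y ≡ 2 * q + 1 * p → z ≡ 13 * q + 8 * p → z' ≡ 21 * q + 13 * p →
    2 + z * z + 6 * y * z' < 4 + y * y + z' * z' + 3 * z
  lemma _ _ _ p q refl refl refl =
    ≤-trans (m<m+n _ (m≤n⇒m≤o+n (24 * (q * q) + 60 * (p * q) + 28 * (p * p) + 3 * (13 * q + 8 * p)) (s≤s z≤n)))
      (≤-reflexive (expand p q))

-- The greatest triple for c is (2, 2, c), the least for c' is (3, c' - 4, c'); between them lies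
-- (2, 2, c' - 2).
far : ∀ {a b c a' b' c'} → Code (a , b , c) → Code (a' , b' , c') → 2 + c ≤ c' → (a , b , c) ≺ (a' , b' , c')
far {c = c} code code' le with m≤n⇒∃[o]m+o≡n (≤-trans (+-monoʳ-≤ 2 (code-c≥5 code)) le)
... | n , refl =
  ≼-≺-trans (≼-two-two code)
  (≼-≺-trans (two-two-mono (≤-trans (s≤s (s≤s (s≤s z≤n))) (code-c≥5 code)) (s≤s⁻¹ (s≤s⁻¹ le)))
  (≺-≼-trans (two-two-≺-three n)
    (three-≼ (3 + n) (s≤s (s≤s (s≤s z≤n))) code' (s≤s⁻¹ (proj₂ (proj₂ code'))) ≤-refl)))

near : ∀ {a b c a' b'} → Code (a , b , c) → Code (a' , b' , suc c) → a' + b' < c → (a , b , c) ≺ (a' , b' , suc c)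
near {c = c} {a'} {b'} code code' lt with m≤n⇒∃[o]m+o≡n (code-c≥5 code)
... | n , refl = ≼-≺-trans (≼-two-two code) (base n code' lt)
  where
  base : ∀ n → Code (a' , b' , 6 + n) → a' + b' < 5 + n → (2 , 2 , 5 + n) ≺ (a' , b' , 6 + n)
  -- For c = 5 and c = 6 the sum a' + b' is at most 5, which forces a' = 2; from c = 7 on, (3, c -
  -- 4, c + 1) is the lower bound.
  base zero code' lt = ≺-≼-trans (evaluate _ _)
    (two-≼ 2 ≤-refl code' (s≤s⁻¹ lt) (inj₁ (half 2 (proj₁ code') (proj₁ (proj₂ code')) (<⇒≤ lt))) (n≤1+n 5))
  base (suc zero) code' lt = ≺-≼-trans (evaluate _ _)
    (two-≼ 3 (n≤1+n 2) code' (s≤s⁻¹ lt) (inj₁ (half 2 (proj₁ code') (proj₁ (proj₂ code')) (s≤s⁻¹ lt))) (n≤1+n 6))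
  base (suc (suc n)) code' lt = ≺-≼-trans (two-two-≺-next n)
    (three-≼ (3 + n) (s≤s (s≤s (s≤s z≤n))) code' (s≤s⁻¹ lt) (n≤1+n (7 + n)))

-- One-parameter families of neighbouring triples.

two-≺-two-next : ∀ n → (2 , 4 + n , 11 + n) ≺ (2 , 9 + n , 12 + n)
-- `shift n` raises the last two indices by n + 1, so the base triples start one lower.
two-≺-two-next = coefficientwise (2 , 3 , 10) (2 , 8 , 11)

two-next-≺-two : ∀ n → (2 , 8 + n , 11 + n) ≺ (2 , 2 + n , 10 + n)
two-next-≺-two = coefficientwise (2 , 7 , 10) (2 , 1 , 9)

two-next-≺-three : ∀ n → (2 , 10 + n , 13 + n) ≺ (3 , 3 + n , 12 + n)
two-next-≺-three = coefficientwise (2 , 9 , 12) (3 , 2 , 11)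

two-≺-three-next : ∀ n → (2 , 4 + n , 7 + n) ≺ (3 , 4 + n , 8 + n)
-- From the base (2, 3, 6), (3, 3, 7) the test on p² fails, 224 against 221, so the family starts
-- one later and `zero` is computed.
two-≺-three-next zero = evaluate _ _
two-≺-three-next (suc n) = coefficientwise (2 , 4 , 7) (3 , 4 , 8) n

four-next-≺-two : ∀ n → (4 , 4 + n , 9 + n) ≺ (2 , 4 + n , 8 + n)
four-next-≺-two = coefficientwise (4 , 3 , 8) (2 , 3 , 7)

three-≺-four-next : ∀ n → (3 , 3 + n , 8 + n) ≺ (4 , 4 + n , 9 + n)
three-≺-four-next zero = evaluate _ _
three-≺-four-next (suc n) = coefficientwise (3 , 3 , 8) (4 , 4 , 9) n

four-≺-four-next : ∀ n → (4 , 4 + n , 10 + n) ≺ (4 , 6 + n , 11 + n)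
four-≺-four-next = coefficientwise (4 , 3 , 9) (4 , 5 , 10)

three-next-≺-three : ∀ n → (3 , 5 + n , 9 + n) ≺ (3 , 3 + n , 8 + n)
three-next-≺-three = coefficientwise (3 , 4 , 8) (3 , 2 , 7)

five-next-≺-three : ∀ n → (5 , 5 + n , 11 + n) ≺ (3 , 5 + n , 10 + n)
five-next-≺-three zero = evaluate _ _
five-next-≺-three (suc n) = coefficientwise (5 , 5 , 11) (3 , 5 , 10) n

six-next-≺-three : ∀ n → (6 , 7 + n , 14 + n) ≺ (3 , 8 + n , 13 + n)
six-next-≺-three = coefficientwise (6 , 6 , 13) (3 , 7 , 12)

-- The overlap c' = c + 1 = a' + b' + 1.

-- For c = b' + 2 ≥ 10, the triple (2, c - 2, c + 1) lies above the triples with a + b ≥ c - 5 and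
-- below the others. For c ≤ 8 it lies above all, and for c = 9 above all but (2, 2, 9).
adjacent-two : ∀ b' {a b} → 3 ≤ b' → Code (a , b , 2 + b') →
  (a , b , 2 + b') ≺ (2 , b' , 3 + b') ⊎ (2 , b' , 3 + b') ≺ (a , b , 2 + b')
adjacent-two 0 ()
adjacent-two 1 (s≤s ())
adjacent-two 2 (s≤s (s≤s ()))
adjacent-two 3 _ code = inj₁ (≼-≺-trans (≼-two-two code) (evaluate _ _))
adjacent-two 4 _ code = inj₁ (≼-≺-trans (≼-two-two code) (evaluate _ _))
adjacent-two 5 _ code = inj₁ (≼-≺-trans (≼-two-two code) (evaluate _ _))
adjacent-two 6 _ code = inj₁ (≼-≺-trans (≼-two-two code) (evaluate _ _))
adjacent-two 7 {a} {b} _ code@(2≤a , a≤b , _) with 5 ≤? a + b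
... | yes le = inj₁ (≼-≺-trans (≼-two 3 (n≤1+n 2) code le) (evaluate _ _))
... | no ≰ = inj₂ (≺-≼-trans (evaluate _ _)
  (two-≼ 2 ≤-refl code (s≤s⁻¹ (≰⇒> ≰)) (inj₁ (half 2 2≤a a≤b (<⇒≤ (≰⇒> ≰)))) (m≤m+n 5 4)))
adjacent-two 8 {a} {b} _ code@(2≤a , a≤b , _) with 5 ≤? a + b
... | yes le = inj₁ (≼-≺-trans (≼-two 3 (n≤1+n 2) code le) (evaluate _ _))
... | no ≰ = inj₂ (≺-≼-trans (two-next-≺-two 0)
  (two-≼ 2 ≤-refl code (s≤s⁻¹ (≰⇒> ≰)) (inj₁ (half 2 2≤a a≤b (<⇒≤ (≰⇒> ≰)))) (m≤m+n 5 5)))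
adjacent-two (suc (suc (suc (suc (suc (suc (suc (suc (suc n))))))))) {a} {b} _ code@(2≤a , a≤b , lt)
  with 6 + n ≤? a + b
... | yes le = inj₁ (≼-≺-trans (≼-two (4 + n) (s≤s (s≤s z≤n)) code le) (two-≺-two-next n))
... | no ≰ with m≤n⇒m<n∨m≡n (s≤s⁻¹ (≰⇒> ≰)) | m≤n⇒m<n∨m≡n 2≤a
...   | inj₁ less | _         = inj₂ (≺-≼-trans (two-next-≺-two (suc n))
  (two-≼ (3 + n) (s≤s (s≤s z≤n)) code (<⇒≤ less) (inj₂ less) (m≤n+m (6 + n) 5)))
...   | inj₂ same | inj₂ refl = inj₂ (≺-≼-trans (two-next-≺-two (suc n))
  (two-≼ (3 + n) (s≤s (s≤s z≤n)) code (≤-reflexive same) (inj₁ refl) (m≤n+m (6 + n) 5)))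
-- With a ≥ 3 the sum 5 + n is at least 6, so n ≥ 1 and (3, 2 + n, 11 + n) is the least triple of
-- this sum.
...   | inj₂ same | inj₁ 3≤a  = inj₂ (six-or-more n (+-cancelˡ-≤ 5 1 n (≤-trans (+-mono-≤ 3≤a (≤-trans 3≤a a≤b)) (≤-reflexive same))) same lt)
  where
  six-or-more : ∀ n → 1 ≤ n → a + b ≡ 5 + n → a + b < 11 + n → (2 , 9 + n , 12 + n) ≺ (a , b , 11 + n)
  six-or-more (suc n) _ same lt = ≺-≼-trans (two-next-≺-three n) (odd-min-≼ refl (s≤s (s≤s z≤n)) 3≤a a≤b same lt)

sum≥ : ∀ k {a b} → k ≤ a → a ≤ b → k + k ≤ a + b
sum≥ k k≤a a≤b = +-mono-≤ k≤a (≤-trans k≤a a≤b)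

three-min : ∀ n {a b} → 3 ≤ a → a ≤ b → a + b ≡ 6 + n → (3 , 3 + n , 8 + n) ≼ (a , b , 8 + n)
three-min n 3≤a a≤b same =
  odd-min-≼ refl (s≤s (s≤s z≤n)) 3≤a a≤b same (≤-trans (s≤s (≤-reflexive same)) (n≤1+n (7 + n)))

≺-four-next : ∀ n {a b} → 3 ≤ a → a ≤ b → a + b ≡ 6 + n → (a , b , 8 + n) ≺ (4 , 4 + n , 9 + n)
≺-four-next n 3≤a a≤b same with m≤n⇒m<n∨m≡n 3≤a
≺-four-next n 3≤a a≤b refl | inj₂ refl = three-≺-four-next n
≺-four-next n 3≤a a≤b same | inj₁ 4≤a
  with m≤n⇒∃[o]m+o≡n (+-cancelˡ-≤ 6 2 n (≤-trans (sum≥ 4 4≤a a≤b) (≤-reflexive same)))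
... | k , refl = ≼-≺-trans
  (even-max-≼ refl (s≤s (s≤s z≤n)) 4≤a a≤b same (≤-trans (s≤s (≤-reflexive same)) (n≤1+n (9 + k))))
  (four-≺-four-next k)

-- An irregular case of `adjacent-gap-two`: M(3,7,12) = 9677 falls just short of M(6,6,13) = 9681,
-- while (4,6,12) and (5,5,12) lie above.
six-twelve : ∀ {a b a' b'} → 3 ≤ a → a ≤ b → a + b ≡ 10 → 6 ≤ a' → a' ≤ b' → a' + b' ≡ 12 →
  (a , b , 12) ≺ (a' , b' , 13) ⊎ (a' , b' , 13) ≺ (a , b , 12)
six-twelve 3≤a a≤b same 6≤a' a'≤b' same' with half 6 6≤a' a'≤b' (≤-trans (≤-reflexive same') (n≤1+n 12))
six-twelve 3≤a a≤b same 6≤a' a'≤b' refl | refl with m≤n⇒m<n∨m≡n 3≤a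
six-twelve 3≤a a≤b refl 6≤a' a'≤b' refl | refl | inj₂ refl = inj₁ (evaluate _ _)
six-twelve 3≤a a≤b same 6≤a' a'≤b' refl | refl | inj₁ 4≤a with m≤n⇒m<n∨m≡n 4≤a
six-twelve 3≤a a≤b refl 6≤a' a'≤b' refl | refl | inj₁ 4≤a | inj₂ refl = inj₂ (evaluate _ _)
six-twelve 3≤a a≤b same 6≤a' a'≤b' refl | refl | inj₁ 4≤a | inj₁ 5≤a
  with half 5 5≤a a≤b (≤-trans (≤-reflexive same) (n≤1+n 10))
six-twelve 3≤a a≤b refl 6≤a' a'≤b' refl | refl | inj₁ 4≤a | inj₁ 5≤a | refl = inj₂ (evaluate _ _)

-- With c = 8 + n, the triple with a' = 4 lies above all (a, b, c) considered; those with any other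
-- a' lie below the least of these, (3, c - 5, c), except for c = 12 and a' = 6.
adjacent-gap-two : ∀ n {a b a' b'} → 3 ≤ a → a ≤ b → a + b ≡ 6 + n → 3 ≤ a' → a' ≤ b' → a' + b' ≡ 8 + n →
  (a , b , 8 + n) ≺ (a' , b' , 9 + n) ⊎ (a' , b' , 9 + n) ≺ (a , b , 8 + n)
adjacent-gap-two n 3≤a a≤b same 3≤a' a'≤b' same' with m≤n⇒m<n∨m≡n 3≤a'
adjacent-gap-two n 3≤a a≤b same 3≤a' a'≤b' refl | inj₂ refl =
  inj₂ (≺-≼-trans (three-next-≺-three n) (three-min n 3≤a a≤b same))
adjacent-gap-two n 3≤a a≤b same 3≤a' a'≤b' same' | inj₁ 4≤a' with m≤n⇒m<n∨m≡n 4≤a'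
adjacent-gap-two n 3≤a a≤b same 3≤a' a'≤b' refl | inj₁ 4≤a' | inj₂ refl = inj₁ (≺-four-next n 3≤a a≤b same)
adjacent-gap-two n 3≤a a≤b same 3≤a' a'≤b' same' | inj₁ 4≤a' | inj₁ 5≤a'
  with m≤n⇒∃[o]m+o≡n (+-cancelˡ-≤ 8 2 n (≤-trans (sum≥ 5 5≤a' a'≤b') (≤-reflexive same'))) | m≤n⇒m<n∨m≡n 5≤a'
adjacent-gap-two n 3≤a a≤b same 3≤a' a'≤b' refl | inj₁ 4≤a' | inj₁ 5≤a' | k , refl | inj₂ refl =
  inj₂ (≺-≼-trans (five-next-≺-three k) (three-min n 3≤a a≤b same))
adjacent-gap-two n 3≤a a≤b same 3≤a' a'≤b' same' | inj₁ 4≤a' | inj₁ 5≤a' | _ | inj₁ 6≤a'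
  with m≤n⇒m<n∨m≡n (+-cancelˡ-≤ 8 4 n (≤-trans (sum≥ 6 6≤a' a'≤b') (≤-reflexive same')))
... | inj₂ refl = six-twelve 3≤a a≤b same 6≤a' a'≤b' same'
... | inj₁ 5≤n with m≤n⇒∃[o]m+o≡n 5≤n
...   | k , refl = inj₂
  (≼-≺-trans (even-max-≼ refl (s≤s (s≤s z≤n)) 6≤a' a'≤b' same' (s≤s (≤-reflexive same')))
  (≺-≼-trans (six-next-≺-three k) (three-min n 3≤a a≤b same)))

-- If a = 2 or a + b < c - 2, then (4, c - 4, c + 1), the greatest with a' ≥ 3, lies below (2, c -
-- 4, c), which bounds (a, b, c) from below.
adjacent-gap : ∀ n {a b a' b'} → 3 ≤ a' → a' ≤ b' → a' + b' ≡ 8 + n → Code (a , b , 8 + n) → a + b ≤ 6 + n →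
  (a , b , 8 + n) ≺ (a' , b' , 9 + n) ⊎ (a' , b' , 9 + n) ≺ (a , b , 8 + n)
adjacent-gap n {a} {b} {a'} {b'} 3≤a' a'≤b' same' code@(2≤a , a≤b , lt) le
  with m≤n⇒m<n∨m≡n le | m≤n⇒m<n∨m≡n 2≤a
... | inj₂ same | inj₁ 3≤a = adjacent-gap-two n 3≤a a≤b same 3≤a' a'≤b' same'
... | inj₁ less | _        = inj₂ (≼-≺-trans (≼-four (4 + n) (m≤m+n 4 n) 3≤a' a'≤b' same' (s≤s (≤-reflexive same')))
  (≺-≼-trans (four-next-≺-two n) (two-≼ (4 + n) (s≤s (s≤s z≤n)) code le (inj₂ less) (n≤1+n (7 + n)))))
... | inj₂ _    | inj₂ 2≡a = inj₂ (≼-≺-trans (≼-four (4 + n) (m≤m+n 4 n) 3≤a' a'≤b' same' (s≤s (≤-reflexive same')))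
  (≺-≼-trans (four-next-≺-two n) (two-≼ (4 + n) (s≤s (s≤s z≤n)) code le (inj₁ (sym 2≡a)) (n≤1+n (7 + n)))))

-- The index triples of (1, 2, 8) and (2, 2, 13).
Exceptional : Triple → Triple → Set
Exceptional s t = s ≡ (2 , 3 , 6) × t ≡ (3 , 3 , 7)

adjacent-six : ∀ {a b a' b'} → 3 ≤ a' → a' ≤ b' → a' + b' ≡ 6 → Code (a , b , 6) →
  (a' , b' , 7) ≺ (a , b , 6) ⊎ Exceptional (a , b , 6) (a' , b' , 7)
adjacent-six 3≤a' a'≤b' same' (2≤a , a≤b , lt)
  with half 3 3≤a' a'≤b' (≤-trans (≤-reflexive same') (n≤1+n 6)) | half 2 2≤a a≤b (s≤s⁻¹ lt)
adjacent-six {b = suc (suc zero)}                   3≤a' a'≤b' refl (2≤a , a≤b , lt) | refl | refl = inj₁ (evaluate _ _)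
adjacent-six {b = suc (suc (suc zero))}             3≤a' a'≤b' refl (2≤a , a≤b , lt) | refl | refl = inj₂ (refl , refl)
adjacent-six {b = suc (suc (suc (suc _)))}          3≤a' a'≤b' refl (2≤a , a≤b , s≤s (s≤s (s≤s (s≤s (s≤s (s≤s ())))))) | refl | refl
adjacent-six {b = zero}     3≤a' a'≤b' refl (2≤a , () , lt) | refl | refl
adjacent-six {b = suc zero} 3≤a' a'≤b' refl (2≤a , s≤s () , lt) | refl | refl

-- If a + b = c - 1, the greatest triple (2, c - 3, c) lies below the least one with a' ≥ 3, (3, c -
-- 3, c + 1). Smaller sums go to `adjacent-gap`, apart from c = 7.
adjacent-three-or-more : ∀ n {a b a' b'} → 3 ≤ a' → a' ≤ b' → a' + b' ≡ 7 + n → Code (a , b , 7 + n) →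
  (a , b , 7 + n) ≺ (a' , b' , 8 + n) ⊎ (a' , b' , 8 + n) ≺ (a , b , 7 + n)
adjacent-three-or-more n 3≤a' a'≤b' same' code@(2≤a , a≤b , lt) with m≤n⇒m<n∨m≡n (s≤s⁻¹ lt)
adjacent-three-or-more n 3≤a' a'≤b' same' code | inj₂ same = inj₁
  (≼-≺-trans (≼-two (4 + n) (s≤s (s≤s z≤n)) code (≤-reflexive (sym same)))
  (≺-≼-trans (two-≺-three-next n) (odd-min-≼ refl (s≤s (s≤s z≤n)) 3≤a' a'≤b' same' (s≤s (≤-reflexive same')))))
adjacent-three-or-more (suc n) 3≤a' a'≤b' same' code | inj₁ less = adjacent-gap n 3≤a' a'≤b' same' code (s≤s⁻¹ less)
adjacent-three-or-more zero 3≤a' a'≤b' same' code@(2≤a , a≤b , lt) | inj₁ less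
  with half 3 3≤a' a'≤b' (≤-reflexive same')
adjacent-three-or-more zero 3≤a' a'≤b' refl code@(2≤a , a≤b , lt) | inj₁ less | refl = inj₂ (≺-≼-trans (evaluate _ _)
  (two-≼ 3 (n≤1+n 2) code (s≤s⁻¹ less) (inj₁ (half 2 2≤a a≤b (s≤s⁻¹ less))) (n≤1+n 6)))

-- Comparability and uniqueness.

Comparable : Triple → Triple → Set
Comparable s t = s ≺ t ⊎ t ≺ s ⊎ Exceptional s t

adjacent : ∀ {a b c a' b'} → Code (a , b , c) → 2 ≤ a' → a' ≤ b' → a' + b' ≡ c →
  Comparable (a , b , c) (a' , b' , suc c)
adjacent {b' = b'} code 2≤a' a'≤b' same' with m≤n⇒m<n∨m≡n 2≤a'
adjacent {b' = b'} code 2≤a' a'≤b' refl | inj₂ refl with adjacent-two b' (+-cancelˡ-≤ 2 3 b' (code-c≥5 code)) code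
... | inj₁ p = inj₁ p
... | inj₂ p = inj₂ (inj₁ p)
adjacent {c = c} code 2≤a' a'≤b' same' | inj₁ 3≤a' with m≤n⇒m<n∨m≡n (≤-trans (sum≥ 3 3≤a' a'≤b') (≤-reflexive same'))
... | inj₂ refl = inj₂ (adjacent-six 3≤a' a'≤b' same' code)
... | inj₁ 7≤c with m≤n⇒∃[o]m+o≡n 7≤c
...   | n , refl with adjacent-three-or-more n 3≤a' a'≤b' same' code
...     | inj₁ p = inj₁ p
...     | inj₂ p = inj₂ (inj₁ p)

larger-index : ∀ {a b c a' b' c'} → Code (a , b , c) → Code (a' , b' , c') → c < c' →
  Comparable (a , b , c) (a' , b' , c')
larger-index code code'@(2≤a' , a'≤b' , lt') c<c' with m≤n⇒m<n∨m≡n c<c'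
... | inj₁ further = inj₁ (far code code' further)
... | inj₂ refl with m≤n⇒m<n∨m≡n (s≤s⁻¹ lt')
...   | inj₁ less = inj₁ (near code code' less)
...   | inj₂ same = adjacent code 2≤a' a'≤b' same

same-sum : ∀ {a b a' b' c} → Code (a , b , c) → Code (a' , b' , c) → a + b ≡ a' + b' → a < a' →
  (a , b , c) ≺ (a' , b' , c) ⊎ (a' , b' , c) ≺ (a , b , c)
same-sum {a} (2≤a , _ , _) (_ , a'≤b' , lt') same a<a' with even-or-odd a
... | inj₁ even = inj₂ (even-max even 2≤a a<a' a'≤b' (sym same) lt')
... | inj₂ odd  = inj₁ (odd-min odd 2≤a a<a' a'≤b' (sym same) lt')

same-index : ∀ {a b a' b' c} → Code (a , b , c) → Code (a' , b' , c) →
  (a , b , c) ≡ (a' , b' , c) ⊎ (a , b , c) ≺ (a' , b' , c) ⊎ (a' , b' , c) ≺ (a , b , c)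
same-index {a} {b} {a'} {b'} code@(2≤a , a≤b , lt) code'@(2≤a' , a'≤b' , lt') with <-cmp (a + b) (a' + b') | <-cmp a a'
... | tri< less _ _ | _ = inj₂ (inj₂ (larger-sum 2≤a (≤-trans 2≤a a≤b) 2≤a' (≤-trans 2≤a' a'≤b') less lt'))
... | tri> _ _ more | _ = inj₂ (inj₁ (larger-sum 2≤a' (≤-trans 2≤a' a'≤b') 2≤a (≤-trans 2≤a a≤b) more lt))
... | tri≈ _ same _ | tri< a<a' _ _ = inj₂ (same-sum code code' same a<a')
... | tri≈ _ same _ | tri> _ _ a'<a = inj₂ (swap (same-sum code' code (sym same) a'<a))
... | tri≈ _ same _ | tri≈ _ refl _ = inj₁ (cong (λ b → a , b , _) (+-cancelˡ-≡ a b b' same))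

Solves : ℕ → Triple → Set
Solves m t = squares t ≡ product t + m

Solves⇒⊀ : ∀ {m s t} → Solves m s → Solves m t → ¬ s ≺ t
Solves⇒⊀ {m} {s} {t} p q (mk≺ lt) = <-irrefl
  (trans (cong (_+ product t) p) (trans (regroup (product s) m (product t)) (cong (_+ product s) (sym q)))) lt
  where
  regroup : ∀ a m b → a + m + b ≡ b + m + a
  regroup = solve-∀

unique : ∀ {m s t} → Code s → Code t → Solves m s → Solves m t → s ≡ t ⊎ Exceptional s t ⊎ Exceptional t s
unique {s = _ , _ , c} {_ , _ , c'} code code' p q with <-cmp c c'
... | tri< c<c' _ _ with larger-index code code' c<c'
...   | inj₁ lt = contradiction lt (Solves⇒⊀ p q)
...   | inj₂ (inj₁ lt) = contradiction lt (Solves⇒⊀ q p)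
...   | inj₂ (inj₂ e) = inj₂ (inj₁ e)
unique code code' p q | tri> _ _ c'<c with larger-index code' code c'<c
...   | inj₁ lt = contradiction lt (Solves⇒⊀ q p)
...   | inj₂ (inj₁ lt) = contradiction lt (Solves⇒⊀ p q)
...   | inj₂ (inj₂ e) = inj₂ (inj₂ e)
unique code code' p q | tri≈ _ refl _ with same-index code code'
...   | inj₁ eq = inj₁ eq
...   | inj₂ (inj₁ lt) = contradiction lt (Solves⇒⊀ p q)
...   | inj₂ (inj₂ lt) = contradiction lt (Solves⇒⊀ q p)

-- Index triples with c ≤ a + b.

-- The addition formula gives F(a + b) ≤ 2xy + F(a - 1)y, and F(a - 1) < F(a) for a ≥ 3 leaves room
-- for one more y.
F-sum-bound : ∀ {a b} → 3 ≤ a → 1 ≤ b → F (a + b) + F b ≤ 3 * F a * F b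
F-sum-bound {suc a} {suc b} 3≤a _ = begin
  F (suc (a + suc b)) + y                  ≡⟨ cong (_+ y) (F-add a (suc b)) ⟩
  x * F (2 + b) + F a * y + y              ≤⟨ +-monoˡ-≤ y (+-monoˡ-≤ (F a * y) (*-monoʳ-≤ x (F-double b))) ⟩
  x * (2 * y) + F a * y + y                ≡⟨ regroup x y (F a) ⟩
  x * (2 * y) + (1 + F a) * y              ≤⟨ +-monoʳ-≤ (x * (2 * y)) (*-monoˡ-≤ y (F-mono-< {a} (s≤s⁻¹ 3≤a) ≤-refl)) ⟩
  x * (2 * y) + x * y                      ≡⟨ collect x y ⟩
  3 * x * y                                ∎
  where
  open ≤-Reasoning
  x = F (suc a)
  y = F (suc b)
  regroup : ∀ x y w → x * (2 * y) + w * y + y ≡ x * (2 * y) + (1 + w) * y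
  regroup = solve-∀
  collect : ∀ x y → x * (2 * y) + x * y ≡ 3 * x * y
  collect = solve-∀

-- Written with e = 3xy − z, the inequality no longer involves subtraction.
convexity : ∀ x y z e → z + e ≡ 3 * x * y → x * x + y * y ≤ e * z → x * x + y * y + z * z ≤ 3 * x * y * z
convexity x y z e sum le = begin
  x * x + y * y + z * z     ≤⟨ +-monoˡ-≤ (z * z) le ⟩
  e * z + z * z             ≡⟨ regroup e z ⟩
  (z + e) * z               ≡⟨ cong (_* z) sum ⟩
  3 * x * y * z             ∎
  where
  open ≤-Reasoning
  regroup : ∀ e z → e * z + z * z ≡ (z + e) * z
  regroup = solve-∀

-- Both z and e = 3xy - z are at least y, and they sum to at least 6y, so one of them is at least
-- 2y. Hence ez ≥ 2y² ≥ x² + y².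
nonpositive : ∀ x y z → 2 ≤ x → x ≤ y → y ≤ z → z + y ≤ 3 * x * y → x * x + y * y + z * z ≤ 3 * x * y * z
nonpositive x y z 2≤x x≤y y≤z le = convexity x y z e sum (≤-trans (+-monoˡ-≤ (y * y) (*-mono-≤ x≤y x≤y)) bound)
  where
  open ≤-Reasoning
  e = 3 * x * y ∸ z
  sum : z + e ≡ 3 * x * y
  sum = m+[n∸m]≡n (≤-trans (m≤m+n z y) le)
  y≤e : y ≤ e
  y≤e = +-cancelˡ-≤ z y e (≤-trans le (≤-reflexive (sym sum)))
  double : ∀ y → y * y + y * y ≡ y * (2 * y)
  double = solve-∀
  double' : ∀ y → y * y + y * y ≡ 2 * y * y
  double' = solve-∀
  six : ∀ y → 2 * y + 2 * y + 2 * y ≡ 3 * 2 * y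
  six = solve-∀
  bound : y * y + y * y ≤ e * z
  bound with 2 * y ≤? z
  ... | yes 2y≤z = ≤-trans (≤-reflexive (double y)) (*-mono-≤ y≤e 2y≤z)
  ... | no 2y≰z = ≤-trans (≤-reflexive (double' y)) (*-mono-≤ 2y≤e y≤z)
    where
    2y≤e : 2 * y ≤ e
    2y≤e = +-cancelˡ-≤ z (2 * y) e (begin
      z + 2 * y                  ≤⟨ +-monoˡ-≤ (2 * y) (<⇒≤ (≰⇒> 2y≰z)) ⟩
      2 * y + 2 * y              ≤⟨ m≤m+n _ (2 * y) ⟩
      2 * y + 2 * y + 2 * y      ≡⟨ six y ⟩
      3 * 2 * y                  ≤⟨ *-monoˡ-≤ y (*-monoʳ-≤ 3 2≤x) ⟩
      3 * x * y                  ≡⟨ sum ⟨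
      z + e                      ∎)

-- Now e + z is only 3y, but 1 + y² is all that ez must reach: it equals 2y² if z = y, and is at
-- least y(y + 1) if z > y.
nonpositive-one : ∀ y z → 0 < y → y ≤ z → z ≤ 2 * y → 1 * 1 + y * y + z * z ≤ 3 * 1 * y * z
nonpositive-one y z y>0 y≤z z≤2y with m≤n⇒m<n∨m≡n y≤z
... | inj₂ refl = convexity 1 y y (2 * y) (double y)
  (≤-trans (+-monoˡ-≤ (y * y) (*-mono-≤ y>0 y>0)) (≤-reflexive (square y)))
  where
  double : ∀ y → y + 2 * y ≡ 3 * 1 * y
  double = solve-∀
  square : ∀ y → y * y + y * y ≡ 2 * y * y
  square = solve-∀
... | inj₁ y<z = convexity 1 y z e sum (≤-trans (+-monoˡ-≤ (y * y) y>0) (≤-trans (≤-reflexive (sym (*-suc y y))) (*-mono-≤ y≤e y<z)))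
  where
  e = 3 * 1 * y ∸ z
  triple : ∀ y → 2 * y + y ≡ 3 * 1 * y
  triple = solve-∀
  le : z + y ≤ 3 * 1 * y
  le = ≤-trans (+-monoˡ-≤ y z≤2y) (≤-reflexive (triple y))
  sum : z + e ≡ 3 * 1 * y
  sum = m+[n∸m]≡n (≤-trans (m≤m+n z y) le)
  y≤e : y ≤ e
  y≤e = +-cancelˡ-≤ z y e (≤-trans le (≤-reflexive (sym sum)))

Solves⇒≡0 : ∀ {m t} → Solves m t → squares t ≤ product t → m ≡ 0
Solves⇒≡0 {m} {t} p le = n≤0⇒n≡0 (+-cancelˡ-≤ (product t) m 0
  (≤-trans (≤-reflexive (sym p)) (≤-trans le (≤-reflexive (sym (+-identityʳ _))))))

-- With p = F(b) and q = F(b + 1), M = 1 + q² - p(q + p), which Cassini's identity turns into 1 + 1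
-- or, for odd b, 1 - 1.
skip-two-even : ∀ b → parity b ≡ 0ℙ → Solves 2 (2 , b , 2 + b)
skip-two-even b even = lemma (F b) (F (suc b)) (cassini-even b even)
  where
  expand : ∀ p q → 1 * 1 + p * p + (q + p) * (q + p) ≡ 1 + 2 * (p * p) + 2 * (p * q) + q * q
  expand = solve-∀
  expand' : ∀ p q → 1 + 2 * (p * p) + 2 * (p * q) + (p * (q + p) + 1) ≡ 3 * 1 * p * (q + p) + 2
  expand' = solve-∀
  lemma : ∀ p q → q * q ≡ p * (q + p) + 1 → 1 * 1 + p * p + (q + p) * (q + p) ≡ 3 * 1 * p * (q + p) + 2
  lemma p q e = trans (expand p q) (trans (cong (1 + 2 * (p * p) + 2 * (p * q) +_) e) (expand' p q))

skip-two-odd : ∀ b → parity b ≡ 1ℙ → Solves 0 (2 , b , 2 + b)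
skip-two-odd b odd = lemma (F b) (F (suc b)) (cassini-odd b odd)
  where
  expand : ∀ p q → 1 * 1 + p * p + (q + p) * (q + p) ≡ 2 * (p * p) + 2 * (p * q) + (q * q + 1)
  expand = solve-∀
  expand' : ∀ p q → 2 * (p * p) + 2 * (p * q) + p * (q + p) ≡ 3 * 1 * p * (q + p) + 0
  expand' = solve-∀
  lemma : ∀ p q → q * q + 1 ≡ p * (q + p) → 1 * 1 + p * p + (q + p) * (q + p) ≡ 3 * 1 * p * (q + p) + 0
  lemma p q e = trans (expand p q) (trans (cong (2 * (p * p) + 2 * (p * q) +_) e) (expand' p q))

Solves-functional : ∀ {m n t} → Solves m t → Solves n t → m ≡ n
Solves-functional {t = t} p q = +-cancelˡ-≡ (product t) _ _ (trans (sym p) q)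

SkipTwo : ℕ → Triple → Set
SkipTwo m (a , b , c) = a ≡ 2 × 2 ≤ b × c ≡ 2 + b × parity b ≡ 0ℙ × m ≡ 2

classify : ∀ {m a b c} → 0 < m → 2 ≤ a → a ≤ b → b ≤ c → Solves m (a , b , c) →
  Code (a , b , c) ⊎ SkipTwo m (a , b , c)
classify {m} {a} {b} {c} m>0 2≤a a≤b b≤c p with a + b <? c
... | yes lt = inj₁ (2≤a , a≤b , lt)
... | no ≮ with m≤n⇒m<n∨m≡n 2≤a
...   | inj₁ 3≤a = contradiction (Solves⇒≡0 {t = a , b , c} p (nonpositive (F a) (F b) (F c)
  (F-mono-≤ 3≤a) (F-mono-≤ a≤b) (F-mono-≤ b≤c)
  (≤-trans (+-monoˡ-≤ (F b) (F-mono-≤ (≮⇒≥ ≮))) (F-sum-bound 3≤a (≤-trans (s≤s z≤n) (≤-trans 2≤a a≤b))))))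
  (>⇒≢ m>0)
...   | inj₂ refl with m≤n⇒m<n∨m≡n (≮⇒≥ ≮)
...     | inj₁ c<2+b = contradiction (Solves⇒≡0 {t = 2 , b , c} p (nonpositive-one (F b) (F c)
  (F-positive a≤b) (F-mono-≤ b≤c) (≤-trans (F-mono-≤ (s≤s⁻¹ c<2+b)) (double a≤b)))) (>⇒≢ m>0)
  where
  double : ∀ {b} → 2 ≤ b → F (suc b) ≤ 2 * F b
  double {suc b} _ = F-double b
...     | inj₂ refl with even-or-odd b
...       | inj₁ even = inj₂ (refl , a≤b , refl , even , Solves-functional {t = 2 , b , 2 + b} p (skip-two-even b even))
...       | inj₂ odd  = contradiction (Solves-functional {t = 2 , b , 2 + b} p (skip-two-odd b odd)) (>⇒≢ m>0)

-- From Fibonacci solutions to index triples.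

index : ∀ {x} → 0 < x → IsFib x → ∃ λ a → 2 ≤ a × F a ≡ x
index () (zero , refl)
-- The value 1 = F(1) = F(2) is always given the index 2.
index _ (suc zero , refl) = 2 , ≤-refl , refl
index _ (suc (suc a) , eq) = suc (suc a) , s≤s (s≤s z≤n) , eq

F-cancel-≤ : ∀ {a b} → 2 ≤ b → F a ≤ F b → a ≤ b
F-cancel-≤ {a} {b} 2≤b le with b <? a
... | yes b<a = contradiction le (<⇒≱ (F-mono-< 2≤b b<a))
... | no b≮a = ≮⇒≥ b≮a

Fibs : Triple → Triple
Fibs (a , b , c) = F a , F b , F c

decode : ∀ {m t} → 0 < m → FibSolution m t → ∃ λ s → Fibs s ≡ t × Solves m s × (Code s ⊎ SkipTwo m s)
decode m>0 ((x>0 , x≤y , y≤z , p) , fx , fy , fz)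
  with index x>0 fx | index (≤-trans x>0 x≤y) fy | index (≤-trans x>0 (≤-trans x≤y y≤z)) fz
... | a , 2≤a , refl | b , 2≤b , refl | c , 2≤c , refl =
  (a , b , c) , refl , p , classify m>0 2≤a (F-cancel-≤ 2≤b x≤y) (F-cancel-≤ 2≤c y≤z) p

-- The solutions for each m.

at-most-one : (m : ℕ) → 0 < m → m ≢ 2 → m ≢ 21 → (s t : Triple) → FibSolution m s → FibSolution m t → s ≡ t
at-most-one m m>0 m≢2 m≢21 s t fs ft with decode m>0 fs | decode m>0 ft
... | _ , _ , _ , inj₂ (_ , _ , _ , _ , m≡2) | _ = contradiction m≡2 m≢2
... | _ , _ , _ , inj₁ _ | _ , _ , _ , inj₂ (_ , _ , _ , _ , m≡2) = contradiction m≡2 m≢2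
... | k , refl , p , inj₁ code | l , refl , q , inj₁ code' with unique code code' p q
...   | inj₁ eq = cong Fibs eq
...   | inj₂ (inj₁ (refl , _)) = contradiction (Solves-functional {t = 2 , 3 , 6} p refl) m≢21
...   | inj₂ (inj₂ (refl , _)) = contradiction (Solves-functional {t = 2 , 3 , 6} q refl) m≢21

-- Since z ≥ 3xy + 1 by `F-minimal`, M ≥ z(z - 3xy) ≥ z ≥ F(5) = 5.
Code⇒¬Solves-2 : ∀ {t} → Code t → ¬ Solves 2 t
Code⇒¬Solves-2 {a , b , c} code@(2≤a , a≤b , lt) p = <⇒≱ (m≤m+n 3 2) (+-cancelˡ-≤ (3 * x * y * z) 5 2 (begin
  3 * x * y * z + 5             ≤⟨ +-monoʳ-≤ (3 * x * y * z) (F-mono-≤ (code-c≥5 code)) ⟩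
  3 * x * y * z + z             ≡⟨ +-comm (3 * x * y * z) z ⟩
  (1 + 3 * x * y) * z           ≤⟨ *-monoˡ-≤ z (F-minimal 2≤a (≤-trans 2≤a a≤b) lt) ⟩
  z * z                         ≤⟨ m≤n+m (z * z) (x * x + y * y) ⟩
  x * x + y * y + z * z         ≡⟨ p ⟩
  3 * x * y * z + 2             ∎))
  where
  open ≤-Reasoning
  x = F a
  y = F b
  z = F c

parity⇒Even : ∀ n → parity n ≡ 0ℙ → Even n
parity⇒Even zero _ = 0 , refl
parity⇒Even (suc (suc n)) even with parity⇒Even n even
... | k , refl = suc k , cong suc (sym (+-suc k k))

parity-double : ∀ k → parity (k + k) ≡ 0ℙ
parity-double zero = refl
parity-double (suc k) = trans (cong (λ n → parity (suc n)) (+-suc k k)) (parity-double k)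

m≡2-solutions : (t : Triple) →
  (FibSolution 2 t → ∃ λ b → Even b × 2 ≤ b × t ≡ (1 , F b , F (b + 2)))
  × ((∃ λ b → Even b × 2 ≤ b × t ≡ (1 , F b , F (b + 2))) → FibSolution 2 t)
m≡2-solutions t = to , from
  where
  to : FibSolution 2 t → ∃ λ b → Even b × 2 ≤ b × t ≡ (1 , F b , F (b + 2))
  to fs with decode z<s fs
  ... | _ , _ , p , inj₁ code = contradiction p (Code⇒¬Solves-2 code)
  ... | (_ , b , _) , refl , _ , inj₂ (refl , 2≤b , refl , even , _) =
    b , parity⇒Even b even , 2≤b , cong (λ c → 1 , F b , F c) (+-comm 2 b)
  from : (∃ λ b → Even b × 2 ≤ b × t ≡ (1 , F b , F (b + 2))) → FibSolution 2 t
  from (_ , (k , refl) , 2≤b , refl) =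
    (z<s , F-positive 2≤b , F-mono-≤ (m≤m+n (k + k) 2) ,
      subst (λ c → 1 * 1 + F (k + k) * F (k + k) + F c * F c ≡ 3 * 1 * F (k + k) * F c + 2) (+-comm 2 (k + k))
        (skip-two-even (k + k) (parity-double k))) ,
    (1 , refl) , (k + k , refl) , (k + k + 2 , refl)

m≡21-solutions : (t : Triple) →
  (FibSolution 21 t → t ≡ (1 , 2 , 8) ⊎ t ≡ (2 , 2 , 13))
  × (t ≡ (1 , 2 , 8) ⊎ t ≡ (2 , 2 , 13) → FibSolution 21 t)
m≡21-solutions t = to , from
  where
  to : FibSolution 21 t → t ≡ (1 , 2 , 8) ⊎ t ≡ (2 , 2 , 13)
  to fs with decode z<s fs
  -- Every solution is compared with the index triple of (1, 2, 8).
  ... | _ , refl , p , inj₁ code with unique {t = 2 , 3 , 6} code (≤-refl , n≤1+n 2 , ≤-refl) p refl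
  ...   | inj₁ eq = inj₁ (cong Fibs eq)
  ...   | inj₂ (inj₁ (eq , _)) = inj₁ (cong Fibs eq)
  ...   | inj₂ (inj₂ (_ , eq)) = inj₂ (cong Fibs eq)
  from : t ≡ (1 , 2 , 8) ⊎ t ≡ (2 , 2 , 13) → FibSolution 21 t
  from (inj₁ refl) = (z<s , n≤1+n 1 , m≤m+n 2 6 , refl) , (2 , refl) , (3 , refl) , (6 , refl)
  from (inj₂ refl) = (z<s , ≤-refl , m≤m+n 2 11 , refl) , (3 , refl) , (3 , refl) , (7 , refl)

n<F[2+n] : ∀ n → n < F (2 + n)
n<F[2+n] zero = z<s
n<F[2+n] (suc n) = subst (_≤ F (3 + n)) (+-comm (suc n) 1) (+-mono-≤ (n<F[2+n] n) (F-pos n))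

infinitely-many : (N : ℕ) → ∃ λ m → N < m × Σ Triple λ s →
  FibSolution m s × Minimal s × ((t : Triple) → FibSolution m t → t ≡ s)
-- For (1, 1, z) the value is m = 2 + (z - 3)z. The index 7 + N makes z ≥ 13, so m ≥ 132 avoids 2
-- and 21, and m ≥ z ≥ F(N + 2) > N.
infinitely-many N = m , N<m , (1 , 1 , z) , solution , ≤-trans (m≤m+n 3 10) 13≤z ,
  λ t ft → at-most-one m (≤-trans z<s 132≤m) (>⇒≢ (≤-trans (m≤m+n 3 129) 132≤m)) (>⇒≢ (≤-trans (m≤m+n 22 110) 132≤m)) t _ ft solution
  where
  z k m : ℕ
  z = F (7 + N)
  k = z ∸ 3
  m = 2 + k * z
  13≤z : 13 ≤ z
  13≤z = F-mono-≤ {7} (m≤m+n 7 N)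
  10≤k : 10 ≤ k
  10≤k = ∸-monoˡ-≤ 3 13≤z
  132≤m : 132 ≤ m
  132≤m = +-monoʳ-≤ 2 (*-mono-≤ 10≤k 13≤z)
  N<m : N < m
  N<m = ≤-trans (n<F[2+n] N) (≤-trans (F-mono-≤ {2 + N} (m≤n+m (2 + N) 5))
    (≤-trans (≤-reflexive (sym (*-identityˡ z))) (≤-trans (*-monoˡ-≤ z (≤-trans (s≤s z≤n) 10≤k)) (m≤n+m (k * z) 2))))
  equation : 1 * 1 + 1 * 1 + z * z ≡ 3 * 1 * 1 * z + m
  equation = trans (cong (λ w → 2 + w * z) (sym (m+[n∸m]≡n (≤-trans (m≤m+n 3 10) 13≤z)))) (regroup k z)
    where
    regroup : ∀ k z → 2 + (3 + k) * z ≡ 3 * 1 * 1 * z + (2 + k * z)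
    regroup = solve-∀
  solution : FibSolution m (1 , 1 , z)
  solution = (z<s , ≤-refl , ≤-trans (s≤s z≤n) 13≤z , equation) , (1 , refl) , (1 , refl) , (7 + N , refl)

theorem1p1 : ((m : ℕ) → 0 < m → m ≢ 2 → m ≢ 21 →
    (s t : Triple) → FibSolution m s → FibSolution m t → s ≡ t)
    × ((t : Triple) →
    (FibSolution 2 t → ∃ λ b → Even b × 2 ≤ b × t ≡ (1 , F b , F (b + 2)))
    × ((∃ λ b → Even b × 2 ≤ b × t ≡ (1 , F b , F (b + 2))) → FibSolution 2 t))
    × ((t : Triple) →
    (FibSolution 21 t → t ≡ (1 , 2 , 8) ⊎ t ≡ (2 , 2 , 13))
    × (t ≡ (1 , 2 , 8) ⊎ t ≡ (2 , 2 , 13) → FibSolution 21 t))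
    × Minimal (1 , 2 , 8) × Minimal (2 , 2 , 13)
    × ((N : ℕ) → ∃ λ m → N < m × Σ Triple λ s →
    FibSolution m s × Minimal s × ((t : Triple) → FibSolution m t → t ≡ s))
theorem1p1 = at-most-one , m≡2-solutions , m≡21-solutions , m≤m+n 6 2 , m≤m+n 12 1 , infinitely-many
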